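{- Let $\mathcal{A}$ be a separating union-closed family with base set $[n]$, height $h$, and $h=|\mathcal{B}(\mathcal{A})|=4$. Then \[\mathrm{Avg}(\mathcal{A}) = \frac{\sum_{A\in\mathcal{A}}|A|}{|\mathcal{A}|} > \Big\lfloor \frac{n}{2} \Big\rfloor - 1.\]
   Context: A family of sets $\mathcal{A}$ is union-closed if it is a finite family of distinct finite sets with at least one nonempty member set, and $X,Y\in\mathcal{A}$ implies $X\cup Y\in\mathcal{A}$ (the empty set may be a member). For a family $\mathcal{F}$, $b(\mathcal{F})=\bigcup_{F\in\mathcal{F}}F$; the base set $b(\mathcal{A})$ is denoted $[n]=\{1,\dots,n\}$. $\mathcal{A}$ is separating if for any two distinct $x,y\in[n]$ there is $A\in\mathcal{A}$ containing exactly one of $x,y$. A chain in $\mathcal{A}$ is a subfamily any two distinct members of which are comparable under proper inclusion; the height $h$ of $\mathcal{A}$ is the maximum size of a chain in $\mathcal{A}$. For real $x\ge 0$, $\mathcal{A}_{<x}=\{A\in\mathcal{A} : |A|<x\}$. For $\mathcal{S}\subseteq\mathcal{A}$ and $S\in\mathcal{S}$, $\mathrm{irr}_{\mathcal{S}}(S)=\{s\in S : s\notin b(\mathcal{S}\setminus\{S\})\}$, and $\mathcal{S}$ is irredundant if $\mathrm{irr}_{\mathcal{S}}(S)\neq\emptyset$ for every $S\in\mathcal{S}$. Set $B=b(\mathcal{A}_{<n/2})$, and let $\mathcal{B}(\mathcal{A})$ denote any irredundant subfamily of $\mathcal{A}_{<n/2}$ of minimum size such that $b(\mathcal{B}(\mathcal{A}))=B$.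 -}

module Defs where

open import Data.Bool.Properties using () renaming (_≟_ to _≟ᵇ_)
open import Data.Fin using (Fin)
open import Data.Fin.Subset using (Subset; Nonempty; _∈_; _∉_; _⊂_; _∪_; _─_; ⋃; ∣_∣)
open import Data.Integer using (+_)
open import Data.List using (List; []; _∷_; filter; length; map; sum)
open import Data.List.Membership.Propositional using () renaming (_∈_ to _∈ᶠ_)
open import Data.List.Relation.Binary.Subset.Propositional using () renaming (_⊆_ to _⊆ᶠ_)
open import Data.List.Relation.Unary.Any using (Any)
open import Data.List.Relation.Unary.Unique.Propositional using (Unique)
open import Data.Nat using (ℕ; NonZero; _≤_)
open import Data.Product using (∃; _×_)
open import Data.Rational using (ℚ; _/_)
open import Data.Rational.Properties using (_<?_)
open import Data.Sum using (_⊎_)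
open import Data.Vec.Properties using (≡-dec)
open import Relation.Binary.Definitions using (DecidableEquality)
open import Relation.Binary.PropositionalEquality using (_≡_; _≢_)
open import Relation.Nullary using (¬?)

-- A family of subsets of [n] is a list.  Wherever its size matters the list is
-- required to be duplicate-free, so that `length` is the cardinality.
Family : ℕ → Set
Family n = List (Subset n)

private
  variable
    n : ℕ

_≟ˢ_ : DecidableEquality (Subset n)
_≟ˢ_ = ≡-dec _≟ᵇ_

b : Family n → Subset n
b = ⋃

record UnionClosed (𝒜 : Family n) : Set where
  field
    distinct    : Unique 𝒜
    hasNonempty : Any Nonempty 𝒜
    ∪-closed    : ∀ {X Y} → X ∈ᶠ 𝒜 → Y ∈ᶠ 𝒜 → X ∪ Y ∈ᶠ 𝒜

Separating : Family n → Set
Separating {n} 𝒜 = (x y : Fin n) → x ≢ y →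
  ∃ λ A → A ∈ᶠ 𝒜 × ((x ∈ A × y ∉ A) ⊎ (x ∉ A × y ∈ A))

Subfamily : Family n → Family n → Set
Subfamily 𝒮 𝒜 = Unique 𝒮 × 𝒮 ⊆ᶠ 𝒜

Chain : Family n → Family n → Set
Chain 𝒜 𝒞 = Subfamily 𝒞 𝒜 ×
  (∀ {X Y} → X ∈ᶠ 𝒞 → Y ∈ᶠ 𝒞 → X ≢ Y → X ⊂ Y ⊎ Y ⊂ X)

record HasHeight (𝒜 : Family n) (h : ℕ) : Set where
  field
    attained : ∃ λ 𝒞 → Chain 𝒜 𝒞 × length 𝒞 ≡ h
    maximal  : ∀ 𝒞 → Chain 𝒜 𝒞 → length 𝒞 ≤ h

_below_ : Family n → ℚ → Family n
𝒜 below x = filter (λ A → (+ ∣ A ∣ / 1) <? x) 𝒜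

belowHalf : Family n → Family n
belowHalf {n} 𝒜 = 𝒜 below (+ n / 2)

_∖_ : Family n → Subset n → Family n
𝒮 ∖ S = filter (λ T → ¬? (T ≟ˢ S)) 𝒮

irr : Family n → Subset n → Subset n
irr 𝒮 S = S ─ b (𝒮 ∖ S)

Irredundant : Family n → Set
Irredundant 𝒮 = ∀ {S} → S ∈ᶠ 𝒮 → Nonempty (irr 𝒮 S)

record IrredundantCover (𝒜 𝒮 : Family n) : Set where
  field
    subfamily   : Subfamily 𝒮 (belowHalf 𝒜)
    irredundant : Irredundant 𝒮
    covers      : b 𝒮 ≡ b (belowHalf 𝒜)

-- ℬ(𝒜) is not unique; this says that ℬ is an admissible choice of it.
record Isℬ (𝒜 ℬ : Family n) : Set where
  field
    cover   : IrredundantCover 𝒜 ℬ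
    minimum : ∀ 𝒮 → IrredundantCover 𝒜 𝒮 → length ℬ ≤ length 𝒮

Avg : (𝒜 : Family n) → .{{NonZero (length 𝒜)}} → ℚ
Avg 𝒜 = + sum (map ∣_∣ 𝒜) / length 𝒜

unionClosed⇒nonZero : {𝒜 : Family n} → UnionClosed 𝒜 → NonZero (length 𝒜)
unionClosed⇒nonZero {𝒜 = _ ∷ _} _ = _
unionClosed⇒nonZero {𝒜 = []} uc with UnionClosed.hasNonempty uc
... | ()

{-# OPTIONS --safe #-}
module Submission where

-- Call A ∈ 𝒜 small if 2∣A∣ < n.  Minimality of ℬ says that no three small
-- sets cover b(𝒜_{<n/2}), so adding the four members of ℬ one at a time gives
-- a chain of length 4; as the height is 4, ℬ covers [n].  Every 5-chain being
-- excluded: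
--   * a triple of a cover of [n] by four small sets misses exactly one
--     element, because 𝒜 is separating; the remaining elements are covered
--     at least twice, so the four sizes add up to at least 2n − 4;
--   * every small set completes three members of any cover to a cover, hence
--     is a minimal member of 𝒜.
-- With m = ⌊n/2⌋ this forces ∣A∣ ≥ m − 1 for all A ∈ 𝒜, unless n = 2m + 1
-- and ∣A∣ = m − 2 (A is deficient), in which case A and three sets
-- x, y, z of size m form a cover, with x, y, z the same for all deficient A.  Since the union of two
-- deficient sets is not small, the elements covered by x alone are different
-- for different A, so there are at most ∣x∣ = m deficient sets.  Their total
-- deficit is outweighed by the surplus n − (m − 1) ≥ m + 1 of [n] ∈ 𝒜.

open import Defs
open import Data.Bool using (Bool; true; false; not; _∨_)
open import Data.Fin using (Fin; zero; suc)
open import Data.Fin.Properties using (suc-injective) renaming (_≟_ to _≟ᶠ_)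
open import Data.Fin.Subset using (Subset; Nonempty; _∈_; _∉_; _⊆_; _⊂_; _∩_; _∪_; ∁; ⊤; ∣_∣) renaming (_-_ to _-ˢ_)
open import Data.Fin.Subset.Properties
open import Data.Integer using (+_)
import Data.Integer as ℤ
import Data.Integer.Properties as ℤ
open import Data.Integer.Tactic.RingSolver using () renaming (solve-∀ to ℤ-solve-∀)
open import Data.List using (List; []; _∷_; filter; length; map; deduplicate)
open import Data.List.Membership.Propositional using (lose; find) renaming (_∈_ to _∈ᶠ_)
open import Data.List.Membership.Propositional.Properties using (∈-filter⁺; ∈-filter⁻; ∈-deduplicate⁺; ∈-deduplicate⁻)
open import Data.List.Properties using (filter-notAll; filter-none; filter-accept; filter-++; length-++; length-deduplicate)
open import Data.List.Relation.Binary.Subset.Propositional using () renaming (_⊆_ to _⊆ᶠ_)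
open import Data.List.Relation.Unary.All as All using ([]; _∷_)
open import Data.List.Relation.Unary.All.Properties using (¬Any⇒All¬)
open import Data.List.Relation.Unary.AllPairs as AllPairs using (AllPairs; []; _∷_)
open import Data.List.Relation.Unary.Any using (here; there; any?)
open import Data.List.Relation.Unary.Linked using (Linked; [-]; _∷_)
open import Data.List.Relation.Unary.Linked.Properties using (Linked⇒AllPairs)
open import Data.List.Relation.Unary.Unique.DecPropositional.Properties using (deduplicate-!)
open import Data.List.Relation.Unary.Unique.Propositional using (Unique)
open import Data.List.Relation.Unary.Unique.Propositional.Properties using (filter⁺)
open import Data.Nat using (ℕ; zero; suc; NonZero; _+_; _*_; _≤_; _<_; _≤?_; z≤n; s≤s; s≤s⁻¹; ⌊_/2⌋)
open import Data.Nat.Induction using (<-wellFounded; Acc; acc)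
open import Data.Nat.ListAction using (sum)
open import Data.Nat.Properties using (+-assoc; +-comm; +-suc; +-identityʳ; *-suc; *-zeroʳ; *-identityʳ; +-mono-≤; +-mono-<; +-monoˡ-≤; +-monoʳ-≤; +-cancelʳ-≤; ≤-refl; ≤-trans; ≤-reflexive; ≤-antisym; <-irrefl; <-≤-trans; ≤-<-trans; <⇒≱; <⇒≤; ≰⇒>; ≮⇒≥; n≤1+n; m≤n+m; m≤m+n; module ≤-Reasoning)
open import Data.Nat.Tactic.RingSolver using (solve-∀)
open import Data.Product using (∃; _×_; _,_; proj₁; proj₂)
open import Data.Rational using (_/_; _-_; _>_; 1ℚ; toℚᵘ)
import Data.Rational as ℚ
import Data.Rational.Properties as ℚ
open import Data.Rational.Unnormalised using (mkℚᵘ; *<*)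
import Data.Rational.Unnormalised as ℚᵘ
import Data.Rational.Unnormalised.Properties as ℚᵘ
open import Data.Sum using (_⊎_; inj₁; inj₂; [_,_]′)
open import Data.Vec using ([]; _∷_; lookup; tail; here; there)
open import Data.Vec.Properties using (lookup-map; lookup-zipWith; lookup-replicate)
open import Function using (_∘_; id; case_of_)
open import Relation.Binary.PropositionalEquality using (_≡_; _≢_; refl; sym; trans; cong; cong₂; subst; subst₂)
open import Relation.Nullary using (¬_; ¬?; Dec; yes; no; contradiction)
open import Relation.Nullary.Decidable using (decidable-stable; toWitness)

private
  variable
    n : ℕ
    𝒜 𝒮 : Family n

-- Subsets

⊆∧≢⇒⊂ : {p q : Subset n} → p ⊆ q → q ≢ p → p ⊂ q
⊆∧≢⇒⊂ {p = p} {q} p⊆q q≢p with nonempty? (q ∩ ∁ p)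
... | yes (x , x∈) = p⊆q , x , proj₁ (x∈p∩q⁻ q (∁ p) x∈) , x∈∁p⇒x∉p (proj₂ (x∈p∩q⁻ q (∁ p) x∈))
... | no empty = contradiction (⊆-antisym q⊆p p⊆q) q≢p
  where
  q⊆p : q ⊆ p
  q⊆p x∈q = x∉∁p⇒x∈p λ x∈∁p → empty (_ , x∈p∩q⁺ (x∈q , x∈∁p))

p∪q≢p⇒p⊂p∪q : {p q : Subset n} → p ∪ q ≢ p → p ⊂ p ∪ q
p∪q≢p⇒p⊂p∪q {q = q} = ⊆∧≢⇒⊂ (p⊆p∪q q)

p≢⊤⇒p⊂⊤ : {p : Subset n} → p ≢ ⊤ → p ⊂ ⊤
p≢⊤⇒p⊂⊤ p≢⊤ = ⊆∧≢⇒⊂ ⊆⊤ (p≢⊤ ∘ sym)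

x∉p∪q : {p q : Subset n} {x : Fin n} → x ∉ p → x ∉ q → x ∉ p ∪ q
x∉p∪q {p = p} {q} x∉p x∉q = [ x∉p , x∉q ]′ ∘ x∈p∪q⁻ p q

∣p∣≤1 : (p : Subset n) → (∀ {x y} → x ∈ p → y ∈ p → x ≡ y) → ∣ p ∣ ≤ 1
∣p∣≤1 [] _ = z≤n
∣p∣≤1 (false ∷ p) uniq = ∣p∣≤1 p λ x∈p y∈p → suc-injective (uniq (there x∈p) (there y∈p))
∣p∣≤1 {suc n} (true ∷ p) uniq = s≤s (≤-reflexive (trans (cong ∣_∣ (Empty-unique p-empty)) (∣⊥∣≡0 n)))
  where
  p-empty : ¬ Nonempty p
  p-empty (_ , x∈p) with uniq here (there x∈p)
  ... | ()

1≤∣∁p∣ : {p : Subset n} → p ≢ ⊤ → 1 ≤ ∣ ∁ p ∣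
1≤∣∁p∣ {p = p} p≢⊤ with p≢⊤⇒p⊂⊤ p≢⊤
... | _ , x , _ , x∉p = subst (_≤ ∣ ∁ p ∣) (∣⁅x⁆∣≡1 x) (p⊆q⇒∣p∣≤∣q∣ λ y∈ → subst (_∈ ∁ p) (sym (x∈⁅y⁆⇒x≡y x y∈)) (x∉p⇒x∈∁p x∉p))

-- Double counting

χ : Bool → ℕ
χ true  = 1
χ false = 0

degree : List (Subset n) → Fin n → ℕ
degree ps x = sum (map (λ p → χ (lookup p x)) ps)

totalSize : List (Subset n) → ℕ
totalSize ps = sum (map ∣_∣ ps)

private
  tails : List (Subset (suc n)) → List (Subset n)
  tails = map tail

  degree-tails : (ps : List (Subset (suc n))) (x : Fin n) → degree (tails ps) x ≡ degree ps (suc x)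
  degree-tails [] x = refl
  degree-tails ((b ∷ p) ∷ ps) x = cong (_+_ (χ (lookup p x))) (degree-tails ps x)

  ∣b∷p∣ : ∀ b (p : Subset n) → ∣ b ∷ p ∣ ≡ χ b + ∣ p ∣
  ∣b∷p∣ true  p = refl
  ∣b∷p∣ false p = refl

  +-interchange : ∀ a b c d → (a + b) + (c + d) ≡ (a + c) + (b + d)
  +-interchange = solve-∀

  totalSize-split : (ps : List (Subset (suc n))) → totalSize ps ≡ degree ps zero + totalSize (tails ps)
  totalSize-split [] = refl
  totalSize-split ((b ∷ p) ∷ ps) = trans (cong₂ _+_ (∣b∷p∣ b p) (totalSize-split ps)) (+-interchange (χ b) ∣ p ∣ _ _)

  totalSize-empty : (ps : List (Subset 0)) → totalSize ps ≡ 0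
  totalSize-empty [] = refl
  totalSize-empty ([] ∷ ps) = totalSize-empty ps

-- The total size is the sum of the degrees of the elements. The induction on `n` splits off the
-- degree of the first element and passes to the tails.
totalSize-mono : (ps qs : List (Subset n)) → (∀ x → degree ps x ≤ degree qs x) → totalSize ps ≤ totalSize qs
totalSize-mono {zero} ps qs _ = ≤-reflexive (trans (totalSize-empty ps) (sym (totalSize-empty qs)))
totalSize-mono {suc n} ps qs ps≤qs = subst₂ _≤_ (sym (totalSize-split ps)) (sym (totalSize-split qs))
  (+-mono-≤ (ps≤qs zero) (totalSize-mono (tails ps) (tails qs)
    λ x → subst₂ _≤_ (sym (degree-tails ps x)) (sym (degree-tails qs x)) (ps≤qs (suc x))))

lookup-∁ : (p : Subset n) (x : Fin n) → lookup (∁ p) x ≡ not (lookup p x)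
lookup-∁ p x = lookup-map x not p

lookup-∪ : (p q : Subset n) (x : Fin n) → lookup (p ∪ q) x ≡ lookup p x ∨ lookup q x
lookup-∪ p q x = lookup-zipWith _∨_ x p q

lookup-∁∪ : (p q r : Subset n) (x : Fin n) →
  lookup (∁ ((p ∪ q) ∪ r)) x ≡ not ((lookup p x ∨ lookup q x) ∨ lookup r x)
lookup-∁∪ p q r x rewrite lookup-∁ ((p ∪ q) ∪ r) x | lookup-∪ (p ∪ q) r x | lookup-∪ p q x = refl

lookup-⊤ : (x : Fin n) → lookup ⊤ x ≡ true
lookup-⊤ x = lookup-replicate x true

-- A gap is what three of the four sets leave uncovered. The triples are listed as the cyclic shifts
-- of `a b c d`, to match `rotate`; the tail `ps` allows two such lists to be nested.
withGaps : (a b c d : Subset n) → List (Subset n) → List (Subset n)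
withGaps a b c d ps = a ∷ b ∷ c ∷ d ∷ ∁ ((a ∪ b) ∪ c) ∷ ∁ ((b ∪ c) ∪ d) ∷ ∁ ((c ∪ d) ∪ a) ∷ ∁ ((d ∪ a) ∪ b) ∷ ps

withGapsᵇ : (a b c d : Bool) → List Bool → List Bool
withGapsᵇ a b c d ps = a ∷ b ∷ c ∷ d ∷ not ((a ∨ b) ∨ c) ∷ not ((b ∨ c) ∨ d) ∷ not ((c ∨ d) ∨ a) ∷ not ((d ∨ a) ∨ b) ∷ ps

count : List Bool → ℕ
count bs = sum (map χ bs)

-- Makes the two tables below decidable, so that evaluation checks all membership patterns of a
-- single element.
∀ᵇ : {P : Bool → Set} → (∀ b → Dec (P b)) → Dec (∀ b → P b)
∀ᵇ P? with P? true | P? false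
... | yes pt | yes pf = yes λ { true → pt ; false → pf }
... | no ¬pt | _ = no λ p → ¬pt (p true)
... | yes _ | no ¬pf = no λ p → ¬pf (p false)

-- An element of exactly one set is counted again in the gap of the other three; an element of no
-- set lies in all four gaps.
gaps-table : ∀ a b c d → 2 ≤ count (withGapsᵇ a b c d [])
gaps-table = toWitness {a? = ∀ᵇ λ a → ∀ᵇ λ b → ∀ᵇ λ c → ∀ᵇ λ d → 2 ≤? count (withGapsᵇ a b c d [])} _

-- The right-hand side is at least 2 + 2 + 2 by gaps-table; its excess pays for
-- elements of d or e lying in two of a, b, c, and for those in all three.
twoGaps-table : ∀ d e a b c →
  4 + count ((d ∨ e) ∷ a ∷ b ∷ c ∷ not ((a ∨ b) ∨ c) ∷ not (((d ∨ e) ∨ b) ∨ c) ∷ []) ≤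
  2 + count (withGapsᵇ d a b c (withGapsᵇ e a b c []))
twoGaps-table = toWitness {a? = ∀ᵇ λ d → ∀ᵇ λ e → ∀ᵇ λ a → ∀ᵇ λ b → ∀ᵇ λ c → _ ≤? _} _

gaps-bound : (a b c d : Subset n) → totalSize {n} (⊤ ∷ ⊤ ∷ []) ≤ totalSize (withGaps a b c d [])
gaps-bound {n} a b c d = totalSize-mono (⊤ ∷ ⊤ ∷ []) (withGaps a b c d []) pointwise
  where
  pointwise : (x : Fin n) → degree (⊤ ∷ ⊤ ∷ []) x ≤ degree (withGaps a b c d []) x
  pointwise x rewrite lookup-⊤ x
    | lookup-∁∪ a b c x | lookup-∁∪ b c d x | lookup-∁∪ c d a x | lookup-∁∪ d a b x =
    gaps-table (lookup a x) (lookup b x) (lookup c x) (lookup d x)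

-- To be used with two deficient sets `d`, `e` that form covers with the same `a`, `b`, `c`. Each
-- `⊤` contributes the constant 1 at every element.
twoGaps-bound : (d e a b c : Subset n) →
  totalSize (⊤ ∷ ⊤ ∷ ⊤ ∷ ⊤ ∷ (d ∪ e) ∷ a ∷ b ∷ c ∷ ∁ ((a ∪ b) ∪ c) ∷ ∁ (((d ∪ e) ∪ b) ∪ c) ∷ []) ≤
  totalSize (⊤ ∷ ⊤ ∷ withGaps d a b c (withGaps e a b c []))
twoGaps-bound {n} d e a b c = totalSize-mono ps qs pointwise
  where
  ps qs : Family n
  ps = ⊤ ∷ ⊤ ∷ ⊤ ∷ ⊤ ∷ (d ∪ e) ∷ a ∷ b ∷ c ∷ ∁ ((a ∪ b) ∪ c) ∷ ∁ (((d ∪ e) ∪ b) ∪ c) ∷ []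
  qs = ⊤ ∷ ⊤ ∷ withGaps d a b c (withGaps e a b c [])
  pointwise : (x : Fin n) → degree ps x ≤ degree qs x
  pointwise x rewrite lookup-⊤ x | lookup-∁∪ (d ∪ e) b c x | lookup-∪ d e x
    | lookup-∁∪ a b c x
    | lookup-∁∪ d a b x | lookup-∁∪ b c d x | lookup-∁∪ c d a x
    | lookup-∁∪ e a b x | lookup-∁∪ b c e x | lookup-∁∪ c e a x =
    twoGaps-table (lookup d x) (lookup e x) (lookup a x) (lookup b x) (lookup c x)

-- Pigeonhole, with the injection given as a relation `Q`: the element chosen for the head is
-- removed from `p`, and no later set can choose it.
length≤∣p∣ : (Q : Subset n → Fin n → Set) (𝒟 : Family n) (p : Subset n) → Unique 𝒟 →
  (∀ {D} → D ∈ᶠ 𝒟 → ∃ λ x → x ∈ p × Q D x) →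
  (∀ {D E x} → D ∈ᶠ 𝒟 → E ∈ᶠ 𝒟 → Q D x → Q E x → D ≡ E) →
  length 𝒟 ≤ ∣ p ∣
length≤∣p∣ Q [] p _ _ _ = z≤n
length≤∣p∣ Q (D ∷ 𝒟) p (D∉𝒟 ∷ uniq) choose inj with choose (here refl)
... | x , x∈p , QDx = ≤-<-trans (length≤∣p∣ Q 𝒟 (p -ˢ x) uniq choose′ λ D∈ E∈ → inj (there D∈) (there E∈)) (x∈p⇒∣p-x∣<∣p∣ x∈p)
  where
  choose′ : ∀ {E} → E ∈ᶠ 𝒟 → ∃ λ y → y ∈ p -ˢ x × Q E y
  choose′ E∈ with choose (there E∈)
  ... | y , y∈p , QEy = y , x∈p∧x≢y⇒x∈p-y y∈p y≢x , QEy
    where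
    y≢x : y ≢ x
    y≢x refl = All.lookup D∉𝒟 E∈ (inj (here refl) (there E∈) QDx QEy)

private
  module _ {p q r : Subset n} {x : Fin n} (x∉ : x ∉ (p ∪ q) ∪ r) where
    ∉₁ : x ∉ p
    ∉₁ = x∉ ∘ x∈p∪q⁺ ∘ inj₁ ∘ x∈p∪q⁺ ∘ inj₁

    ∉₂ : x ∉ q
    ∉₂ = x∉ ∘ x∈p∪q⁺ ∘ inj₁ ∘ x∈p∪q⁺ ∘ inj₂

    ∉₃ : x ∉ r
    ∉₃ = x∉ ∘ x∈p∪q⁺ ∘ inj₂

-- Arithmetic

n≡2⌊n/2⌋⊎1+2⌊n/2⌋ : ∀ n → n ≡ ⌊ n /2⌋ + ⌊ n /2⌋ ⊎ n ≡ suc (⌊ n /2⌋ + ⌊ n /2⌋)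
n≡2⌊n/2⌋⊎1+2⌊n/2⌋ 0 = inj₁ refl
n≡2⌊n/2⌋⊎1+2⌊n/2⌋ 1 = inj₂ refl
n≡2⌊n/2⌋⊎1+2⌊n/2⌋ (suc (suc n)) with n≡2⌊n/2⌋⊎1+2⌊n/2⌋ n
... | inj₁ eq = inj₁ (cong suc (trans (cong suc eq) (sym (+-suc ⌊ n /2⌋ ⌊ n /2⌋))))
... | inj₂ eq = inj₂ (cong suc (cong suc (trans eq (sym (+-suc ⌊ n /2⌋ ⌊ n /2⌋)))))

u+u<m+m⇒u<m : ∀ {u m} → u + u < m + m → u < m
u+u<m+m⇒u<m u+u<m+m = ≰⇒> λ m≤u → <-irrefl refl (<-≤-trans u+u<m+m (+-mono-≤ m≤u m≤u))

u+u≤m+m⇒u≤m : ∀ {u m} → u + u ≤ m + m → u ≤ m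
u+u≤m+m⇒u≤m u+u≤m+m = ≮⇒≥ λ m<u → <-irrefl refl (<-≤-trans (+-mono-< m<u m<u) u+u≤m+m)

squeeze : ∀ {m a b c d} → a ≤ m → b ≤ m → c ≤ m → d ≤ m → (m + m) + (m + m) ≤ (a + b) + (c + d) → a ≡ m
squeeze {m} {a} {b} {c} {d} a≤m b≤m c≤m d≤m 4m≤ = ≤-antisym a≤m (+-cancelʳ-≤ (m + (m + m)) m a (begin
  m + (m + (m + m))   ≡⟨ sym (+-assoc m m (m + m)) ⟩
  (m + m) + (m + m)   ≤⟨ 4m≤ ⟩
  (a + b) + (c + d)   ≡⟨ +-assoc a b (c + d) ⟩
  a + (b + (c + d))   ≤⟨ +-monoʳ-≤ a (+-mono-≤ b≤m (+-mono-≤ c≤m d≤m)) ⟩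
  a + (m + (m + m))   ∎))
  where open ≤-Reasoning

-- If `n` is even, small sets have size at most `m - 1`, and the right-hand side falls one short of
-- `4m`. If `n` is odd, they have size at most `m`, and the bound leaves no slack, which forces all
-- four equalities.
tight-cover : ∀ {n m d u v w} → n ≡ m + m ⊎ n ≡ suc (m + m) → 2 + d ≤ m →
  u + u < n → v + v < n → w + w < n → n + n ≤ ((d + u) + (v + w)) + 4 →
  n ≡ suc (m + m) × 2 + d ≡ m × u ≡ m × v ≡ m × w ≡ m
tight-cover {m = m} {d} {u} {v} {w} (inj₁ refl) d<m u< v< w< 2n≤ =
  contradiction 2n≤ (<⇒≱ (begin
    suc (((d + u) + (v + w)) + 4)                    ≡⟨ eq d u v w ⟩
    ((2 + d) + suc u) + (suc v + suc w)              ≤⟨ +-mono-≤ (+-mono-≤ d<m (u+u<m+m⇒u<m {m = m} u<)) (+-mono-≤ (u+u<m+m⇒u<m {m = m} v<) (u+u<m+m⇒u<m {m = m} w<)) ⟩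
    (m + m) + (m + m)                                ∎))
  where
  open ≤-Reasoning
  eq : ∀ d u v w → suc (((d + u) + (v + w)) + 4) ≡ ((2 + d) + suc u) + (suc v + suc w)
  eq = solve-∀
tight-cover {m = m} {d} {u} {v} {w} (inj₂ refl) d<m (s≤s u<) (s≤s v<) (s≤s w<) 2n≤ =
  refl ,
  -- `squeeze` determines only its first summand, so the sum is permuted to bring each of the four
  -- to the front.
  squeeze d<m u≤m v≤m w≤m 4m≤ ,
  squeeze u≤m d<m v≤m w≤m (subst ((m + m) + (m + m) ≤_) (cong (_+ (v + w)) (+-comm (2 + d) u)) 4m≤) ,
  squeeze v≤m w≤m d<m u≤m (subst ((m + m) + (m + m) ≤_) (+-comm ((2 + d) + u) (v + w)) 4m≤) ,
  squeeze w≤m v≤m d<m u≤m (subst ((m + m) + (m + m) ≤_) (trans (+-comm ((2 + d) + u) (v + w)) (cong (_+ ((2 + d) + u)) (+-comm v w))) 4m≤)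
  where
  u≤m = u+u≤m+m⇒u≤m u<
  v≤m = u+u≤m+m⇒u≤m v<
  w≤m = u+u≤m+m⇒u≤m w<
  eqˡ : ∀ m → suc (m + m) + suc (m + m) ≡ ((m + m) + (m + m)) + 2
  eqˡ = solve-∀
  eqʳ : ∀ d u v w → ((d + u) + (v + w)) + 4 ≡ (((2 + d) + u) + (v + w)) + 2
  eqʳ = solve-∀
  4m≤ : (m + m) + (m + m) ≤ ((2 + d) + u) + (v + w)
  4m≤ = +-cancelʳ-≤ 2 _ _ (subst₂ _≤_ (eqˡ m) (eqʳ d u v w) 2n≤)

⌊n/2⌋+⌊n/2⌋≤n : ∀ n → ⌊ n /2⌋ + ⌊ n /2⌋ ≤ n
⌊n/2⌋+⌊n/2⌋≤n n with n≡2⌊n/2⌋⊎1+2⌊n/2⌋ n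
... | inj₁ eq = ≤-reflexive (sym eq)
... | inj₂ eq = ≤-trans (n≤1+n _) (≤-reflexive (sym eq))

-- The right-hand side equals `6n = 12m + 6`. Since `u` is at least `m + 1` and both gaps `g`, `h`
-- are nonempty, the left-hand side is at least `12m + 7`.
twoGaps-absurd : ∀ {n m d e x y z u g h} →
  n ≡ suc (m + m) → 2 + d ≡ m → 2 + e ≡ m → x ≡ m → y ≡ m → z ≡ m → suc (m + m) ≤ u + u → 1 ≤ g → 1 ≤ h →
  ¬ (n + (n + (n + (n + (u + (x + (y + (z + (g + (h + 0)))))))))
     ≤ n + (n + (d + (x + (y + (z + (4 + (e + (x + (y + (z + (4 + 0))))))))))))
twoGaps-absurd {d = d} {u = u} refl refl refl refl refl refl m<u 1≤g 1≤h ≤′ = <-irrefl refl (begin-strict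
  N + (N + (N + (N + ((3 + d) + (M + (M + (M + 2)))))))  ≤⟨ mono N M (u+u<m+m⇒u<m {m = u} m<u) 1≤g 1≤h ⟩
  _  ≤⟨ ≤′ ⟩
  N + (N + (d + (M + (M + (M + (4 + (d + (M + (M + (M + 4))))))))))  <⟨ ≤-reflexive (eq d) ⟩
  N + (N + (N + (N + ((3 + d) + (M + (M + (M + 2)))))))  ∎)
  where
  open ≤-Reasoning
  M = 2 + d
  N = suc (M + M)
  mono : ∀ N M {u g h} → M < u → 1 ≤ g → 1 ≤ h →
    N + (N + (N + (N + (suc M + (M + (M + (M + 2))))))) ≤ N + (N + (N + (N + (u + (M + (M + (M + (g + (h + 0)))))))))
  mono N M M<u 1≤g 1≤h = +-monoʳ-≤ N (+-monoʳ-≤ N (+-monoʳ-≤ N (+-monoʳ-≤ N (+-mono-≤ M<u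
    (+-monoʳ-≤ M (+-monoʳ-≤ M (+-monoʳ-≤ M (+-mono-≤ 1≤g (+-monoˡ-≤ 0 1≤h)))))))))
  eq : ∀ d →
    suc (suc (2 + d + (2 + d)) + (suc (2 + d + (2 + d)) + (d + ((2 + d) + ((2 + d) + ((2 + d) + (4 + (d + ((2 + d) + ((2 + d) + ((2 + d) + 4))))))))))) ≡
    suc (2 + d + (2 + d)) + (suc (2 + d + (2 + d)) + (suc (2 + d + (2 + d)) + (suc (2 + d + (2 + d)) + ((3 + d) + ((2 + d) + ((2 + d) + ((2 + d) + 2)))))))
  eq = solve-∀

-- Fractions

-- `_/_` normalises its fraction, so the comparison is made on unnormalised rationals, where `<` is
-- cross-multiplication.
/-mono-< : ∀ a b c d → a * suc d < b * suc c → + a / suc c ℚ.< + b / suc d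
/-mono-< a b c d lt = ℚ.toℚᵘ-cancel-< (ℚᵘ.<-respˡ-≃ (ℚᵘ.≃-sym (ℚ.toℚᵘ-fromℚᵘ (mkℚᵘ (+ a) c)))
  (ℚᵘ.<-respʳ-≃ (ℚᵘ.≃-sym (ℚ.toℚᵘ-fromℚᵘ (mkℚᵘ (+ b) d)))
    (*<* (subst₂ ℤ._<_ (ℤ.pos-* a (suc d)) (ℤ.pos-* b (suc c)) (ℤ.+<+ lt)))))

/-cancel-< : ∀ a b c d → + a / suc c ℚ.< + b / suc d → a * suc d < b * suc c
/-cancel-< a b c d lt with ℚᵘ.<-respˡ-≃ (ℚ.toℚᵘ-fromℚᵘ (mkℚᵘ (+ a) c))
  (ℚᵘ.<-respʳ-≃ (ℚ.toℚᵘ-fromℚᵘ (mkℚᵘ (+ b) d)) (ℚ.toℚᵘ-mono-< lt))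
... | *<* lt′ = ℤ.drop‿+<+ (subst₂ ℤ._<_ (sym (ℤ.pos-* a (suc d))) (sym (ℤ.pos-* b (suc c))) lt′)

-- The hypothesis is the cross-multiplied conclusion with `l` added on both sides, which keeps it
-- free of truncated subtraction.
m-1</ : ∀ m s l .{{_ : NonZero l}} → m * l < s + l → (+ m / 1) - 1ℚ ℚ.< + s / l
m-1</ m s l@(suc l-1) lt = ℚ.toℚᵘ-cancel-<
  (ℚᵘ.<-respˡ-≃ (ℚᵘ.≃-sym m-1) (ℚᵘ.<-respʳ-≃ (ℚᵘ.≃-sym (ℚ.toℚᵘ-fromℚᵘ (mkℚᵘ (+ s) l-1))) (*<* [m-1]l<s)))
  where
  m-1 : toℚᵘ ((+ m / 1) - 1ℚ) ℚᵘ.≃ mkℚᵘ (+ m) 0 ℚᵘ.- ℚᵘ.1ℚᵘ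
  m-1 = ℚᵘ.≃-trans (ℚ.toℚᵘ-homo-+ (+ m / 1) (ℚ.- 1ℚ)) (ℚᵘ.+-congˡ (ℚᵘ.- ℚᵘ.1ℚᵘ) (ℚ.toℚᵘ-fromℚᵘ (mkℚᵘ (+ m) 0)))
  eqˡ : ∀ i k → i ℤ.* k ℤ.+ ℤ.- k ≡ (i ℤ.* + 1 ℤ.+ ℤ.-1ℤ ℤ.* + 1) ℤ.* k
  eqˡ = ℤ-solve-∀
  eqʳ : ∀ i k → (i ℤ.+ k) ℤ.+ ℤ.- k ≡ i ℤ.* + 1
  eqʳ = ℤ-solve-∀
  [m-1]l<s : (+ m ℤ.* + 1 ℤ.+ ℤ.-1ℤ ℤ.* + 1) ℤ.* + l ℤ.< + s ℤ.* + 1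
  [m-1]l<s = subst₂ ℤ._<_
    (trans (cong (ℤ._+ (ℤ.- + l)) (ℤ.pos-* m l)) (eqˡ (+ m) (+ l))) (eqʳ (+ s) (+ l))
    (ℤ.+-monoˡ-< (ℤ.- + l) (ℤ.+<+ lt))

-- Families

⊆b : {S : Subset n} → S ∈ᶠ 𝒮 → S ⊆ b 𝒮
⊆b (here refl) = p⊆p∪q _
⊆b (there S∈) x∈S = q⊆p∪q _ _ (⊆b S∈ x∈S)

b⊆ : (𝒮 : Family n) {p : Subset n} → (∀ {S} → S ∈ᶠ 𝒮 → S ⊆ p) → b 𝒮 ⊆ p
b⊆ [] _ x∈ = contradiction x∈ ∉⊥
b⊆ (S ∷ 𝒮) S⊆p x∈ with x∈p∪q⁻ S (b 𝒮) x∈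
... | inj₁ x∈S = S⊆p (here refl) x∈S
... | inj₂ x∈b𝒮 = b⊆ 𝒮 (S⊆p ∘ there) x∈b𝒮

b∈ : UnionClosed 𝒜 → (S : Subset n) (𝒮 : Family n) → (S ∷ 𝒮) ⊆ᶠ 𝒜 → b (S ∷ 𝒮) ∈ᶠ 𝒜
b∈ {𝒜 = 𝒜} uc S [] 𝒮⊆𝒜 = subst (_∈ᶠ 𝒜) (sym (∪-identityʳ S)) (𝒮⊆𝒜 (here refl))
b∈ uc S (T ∷ 𝒮) 𝒮⊆𝒜 = UnionClosed.∪-closed uc (𝒮⊆𝒜 (here refl)) (b∈ uc T 𝒮 (𝒮⊆𝒜 ∘ there))

b𝒜∈𝒜 : UnionClosed 𝒜 → b 𝒜 ∈ᶠ 𝒜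
b𝒜∈𝒜 {𝒜 = []} uc with UnionClosed.hasNonempty uc
... | ()
b𝒜∈𝒜 {𝒜 = A ∷ 𝒜} uc = b∈ uc A 𝒜 id

∈-belowHalf⁺ : {A : Subset n} → A ∈ᶠ 𝒜 → ∣ A ∣ + ∣ A ∣ < n → A ∈ᶠ belowHalf 𝒜
∈-belowHalf⁺ {n} {A = A} A∈ lt = ∈-filter⁺ (λ A → (+ ∣ A ∣ / 1) ℚ.<? (+ n / 2)) A∈ (/-mono-< ∣ A ∣ n 0 1 (subst₂ _<_ (u+u≡u*2 ∣ A ∣) (sym (*-identityʳ n)) lt))
  where
  u+u≡u*2 : ∀ u → u + u ≡ u * 2
  u+u≡u*2 = solve-∀

∈-belowHalf⁻ : {A : Subset n} → A ∈ᶠ belowHalf 𝒜 → A ∈ᶠ 𝒜 × ∣ A ∣ + ∣ A ∣ < n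
∈-belowHalf⁻ {n} {𝒜} {A} A∈ with ∈-filter⁻ (λ A → (+ ∣ A ∣ / 1) ℚ.<? (+ n / 2)) {xs = 𝒜} A∈
... | A∈𝒜 , lt = A∈𝒜 , subst₂ _<_ (u*2≡u+u ∣ A ∣) (*-identityʳ n) (/-cancel-< ∣ A ∣ n 0 1 lt)
  where
  u*2≡u+u : ∀ u → u * 2 ≡ u + u
  u*2≡u+u = solve-∀

private
  AllPairs-comparable : AllPairs _⊂_ 𝒮 → ∀ {X Y} → X ∈ᶠ 𝒮 → Y ∈ᶠ 𝒮 → X ≢ Y → X ⊂ Y ⊎ Y ⊂ X
  AllPairs-comparable (_ ∷ _) (here refl) (here refl) X≢Y = contradiction refl X≢Y
  AllPairs-comparable (X⊂ ∷ _) (here refl) (there Y∈) _ = inj₁ (All.lookup X⊂ Y∈)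
  AllPairs-comparable (Y⊂ ∷ _) (there X∈) (here refl) _ = inj₂ (All.lookup Y⊂ X∈)
  AllPairs-comparable (_ ∷ ps) (there X∈) (there Y∈) X≢Y = AllPairs-comparable ps X∈ Y∈ X≢Y

Linked⇒Chain : Linked _⊂_ 𝒮 → 𝒮 ⊆ᶠ 𝒜 → Chain 𝒜 𝒮
Linked⇒Chain linked 𝒮⊆𝒜 = (AllPairs.map (λ X⊂Y X≡Y → ⊂-irref X≡Y X⊂Y) pairs , 𝒮⊆𝒜) , AllPairs-comparable pairs
  where pairs = Linked⇒AllPairs ⊂-trans linked

-- Irredundant subcovers

b-mono : (𝒯 𝒮 : Family n) → 𝒯 ⊆ᶠ 𝒮 → b 𝒯 ⊆ b 𝒮
b-mono 𝒯 𝒮 𝒯⊆𝒮 = b⊆ 𝒯 (⊆b ∘ 𝒯⊆𝒮)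

∖⊆ : (𝒮 : Family n) (S : Subset n) → 𝒮 ∖ S ⊆ᶠ 𝒮
∖⊆ 𝒮 S T∈ = proj₁ (∈-filter⁻ (λ T → ¬? (T ≟ˢ S)) {xs = 𝒮} T∈)

b-∖ : {S : Subset n} → ¬ Nonempty (irr 𝒮 S) → b (𝒮 ∖ S) ≡ b 𝒮
b-∖ {𝒮 = 𝒮} {S} empty = ⊆-antisym (b-mono (𝒮 ∖ S) 𝒮 (∖⊆ 𝒮 S)) (b⊆ 𝒮 part⊆)
  where
  part⊆ : ∀ {T} → T ∈ᶠ 𝒮 → T ⊆ b (𝒮 ∖ S)
  part⊆ {T} T∈ {x} x∈T with T ≟ˢ S
  ... | no T≢S = ⊆b (∈-filter⁺ (λ T → ¬? (T ≟ˢ S)) T∈ T≢S) x∈T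
  ... | yes refl with x ∈? b (𝒮 ∖ S)
  ... | yes x∈ = x∈
  ... | no x∉ = contradiction (x , x∈p∧x∉q⇒x∈p─q x∈T x∉) empty

-- A member without a private element can be deleted without changing the union; each deletion
-- shortens the list, so the process ends.
irredundantSubcover : (𝒮 : Family n) → Acc _<_ (length 𝒮) → Unique 𝒮 →
  ∃ λ 𝒯 → Subfamily 𝒯 𝒮 × Irredundant 𝒯 × b 𝒯 ≡ b 𝒮 × length 𝒯 ≤ length 𝒮
irredundantSubcover 𝒮 (acc rec) uniq with any? (λ S → ¬? (nonempty? (irr 𝒮 S))) 𝒮
... | no irredundant = 𝒮 , (uniq , id) ,
  (λ {S} S∈ → decidable-stable (nonempty? (irr 𝒮 S)) λ empty → irredundant (lose S∈ empty)) , refl , ≤-refl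
... | yes redundant =
  let S , S∈ , empty = find redundant
      shorter = filter-notAll (λ T → ¬? (T ≟ˢ S)) 𝒮 (lose S∈ λ S≢S → S≢S refl)
      𝒯 , (uniq𝒯 , 𝒯⊆) , irredundant , covers , ≤∖ =
        irredundantSubcover (𝒮 ∖ S) (rec shorter) (filter⁺ (λ T → ¬? (T ≟ˢ S)) uniq)
  in 𝒯 , (uniq𝒯 , ∖⊆ 𝒮 S ∘ 𝒯⊆) , irredundant , trans covers (b-∖ {𝒮 = 𝒮} empty) , ≤-trans ≤∖ (<⇒≤ shorter)

-- Extends minimality to covers that may be redundant or contain repetitions: removing duplicates
-- and thinning out only shortens the list.
ℬ-minimum : {ℬ : Family n} → Isℬ 𝒜 ℬ → (𝒮 : Family n) → 𝒮 ⊆ᶠ belowHalf 𝒜 → b 𝒮 ≡ b (belowHalf 𝒜) →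
  length ℬ ≤ length 𝒮
ℬ-minimum isℬ 𝒮 𝒮⊆ covers =
  let 𝒯 , (uniq , 𝒯⊆) , irredundant , b𝒯≡ , ≤dedup =
        irredundantSubcover (deduplicate _≟ˢ_ 𝒮) (<-wellFounded _) (deduplicate-! _≟ˢ_ 𝒮)
      b-dedup = ⊆-antisym (b-mono (deduplicate _≟ˢ_ 𝒮) 𝒮 (∈-deduplicate⁻ _≟ˢ_ 𝒮))
        (b-mono 𝒮 (deduplicate _≟ˢ_ 𝒮) (∈-deduplicate⁺ _≟ˢ_))
      cover = record
        { subfamily   = uniq , λ T∈ → 𝒮⊆ (∈-deduplicate⁻ _≟ˢ_ 𝒮 (𝒯⊆ T∈))
        ; irredundant = irredundant
        ; covers      = trans b𝒯≡ (trans b-dedup covers) }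
  in ≤-trans (Isℬ.minimum isℬ 𝒯 cover) (≤-trans ≤dedup (length-deduplicate _≟ˢ_ 𝒮))

-- Total size and the number of deficient sets

deficient? : (m : ℕ) (A : Subset n) → Dec (2 + ∣ A ∣ ≤ m)
deficient? m A = 2 + ∣ A ∣ ≤? m

module _ (m : ℕ) where

  private
    δ : Family n → ℕ
    δ 𝒮 = length (filter (deficient? m) 𝒮)

    δ-∷ : (A : Subset n) (𝒮 : Family n) → δ (A ∷ 𝒮) ≡ δ (A ∷ []) + δ 𝒮
    δ-∷ A 𝒮 = trans (cong length (filter-++ (deficient? m) (A ∷ []) 𝒮)) (length-++ (filter (deficient? m) (A ∷ [])))

    m≤∣A∣+1+δ : (A : Subset n) → m ≤ 2 + ∣ A ∣ → m ≤ (∣ A ∣ + 1) + δ (A ∷ [])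
    m≤∣A∣+1+δ A m≤ with deficient? m A
    ... | yes A< = ≤-trans m≤ (≤-reflexive (trans (eq ∣ A ∣) (cong (_+_ (∣ A ∣ + 1)) (cong length (sym (filter-accept (deficient? m) A<))))))
      where
      eq : ∀ k → 2 + k ≡ (k + 1) + 1
      eq = solve-∀
    ... | no A≮ = ≤-trans (s≤s⁻¹ (≰⇒> A≮)) (≤-trans (≤-reflexive (+-comm 1 ∣ A ∣)) (m≤m+n _ _))

    regroup : ∀ a d t l e → ((a + 1) + d) + ((t + l) + e) ≡ ((a + t) + suc l) + (d + e)
    regroup = solve-∀

  size-bound : (𝒮 : Family n) → (∀ {A} → A ∈ᶠ 𝒮 → m ≤ 2 + ∣ A ∣) →
    m * length 𝒮 ≤ (totalSize 𝒮 + length 𝒮) + length (filter (deficient? m) 𝒮)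
  size-bound [] _ = ≤-reflexive (*-zeroʳ m)
  size-bound (A ∷ 𝒮) m≤ rewrite *-suc m (length 𝒮) | δ-∷ A 𝒮 =
    ≤-trans (+-mono-≤ (m≤∣A∣+1+δ A (m≤ (here refl))) (size-bound 𝒮 (m≤ ∘ there)))
      (≤-reflexive (regroup (∣ A ∣) (δ (A ∷ [])) (totalSize 𝒮) (length 𝒮) (δ 𝒮)))

  -- Sharpens `size-bound` at the member `⊤`, which contributes `n + 1` instead of the lower bound
  -- `m`; hence `suc n` on the left and `m` on the right.
  size-bound-⊤ : (𝒮 : Family n) → (∀ {A} → A ∈ᶠ 𝒮 → m ≤ 2 + ∣ A ∣) → ⊤ ∈ᶠ 𝒮 →
    m * length 𝒮 + suc n ≤ ((totalSize 𝒮 + length 𝒮) + length (filter (deficient? m) 𝒮)) + m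
  size-bound-⊤ {n} (A ∷ 𝒮) m≤ (here refl) rewrite *-suc m (length 𝒮) | δ-∷ A 𝒮 = begin
    (m + m * length 𝒮) + suc n
      ≡⟨ cong (λ k → (m + m * length 𝒮) + suc k) (sym (∣⊤∣≡n n)) ⟩
    (m + m * length 𝒮) + suc ∣ A ∣
      ≡⟨ eq₁ m (m * length 𝒮) (∣ A ∣) ⟩
    ((∣ A ∣ + 1) + m) + m * length 𝒮
      ≤⟨ +-mono-≤ (+-monoˡ-≤ m (m≤m+n (∣ A ∣ + 1) (δ (A ∷ [])))) (size-bound 𝒮 (m≤ ∘ there)) ⟩
    (((∣ A ∣ + 1) + δ (A ∷ [])) + m) + ((totalSize 𝒮 + length 𝒮) + δ 𝒮)
      ≡⟨ eq₂ (∣ A ∣) (δ (A ∷ [])) (totalSize 𝒮) (length 𝒮) (δ 𝒮) m ⟩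
    (((∣ A ∣ + totalSize 𝒮) + suc (length 𝒮)) + (δ (A ∷ []) + δ 𝒮)) + m  ∎
    where
    open ≤-Reasoning
    eq₁ : ∀ m k n → (m + k) + suc n ≡ ((n + 1) + m) + k
    eq₁ = solve-∀
    eq₂ : ∀ a d t l e m → (((a + 1) + d) + m) + ((t + l) + e) ≡ (((a + t) + suc l) + (d + e)) + m
    eq₂ = solve-∀
  size-bound-⊤ {n} (A ∷ 𝒮) m≤ (there ⊤∈) rewrite *-suc m (length 𝒮) | δ-∷ A 𝒮 = begin
    (m + m * length 𝒮) + suc n  ≡⟨ +-assoc m (m * length 𝒮) (suc n) ⟩
    m + (m * length 𝒮 + suc n)  ≤⟨ +-mono-≤ (m≤∣A∣+1+δ A (m≤ (here refl))) (size-bound-⊤ 𝒮 (m≤ ∘ there) ⊤∈) ⟩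
    ((∣ A ∣ + 1) + δ (A ∷ [])) + (((totalSize 𝒮 + length 𝒮) + δ 𝒮) + m)  ≡⟨ eq (∣ A ∣) (δ (A ∷ [])) (totalSize 𝒮) (length 𝒮) (δ 𝒮) m ⟩
    (((∣ A ∣ + totalSize 𝒮) + suc (length 𝒮)) + (δ (A ∷ []) + δ 𝒮)) + m  ∎
    where
    open ≤-Reasoning
    eq : ∀ a d t l e m → ((a + 1) + d) + (((t + l) + e) + m) ≡ (((a + t) + suc l) + (d + e)) + m
    eq = solve-∀

-- Covers by four small sets

module _ {n : ℕ} {𝒜 : Family n} (uc : UnionClosed 𝒜) (separating : Separating 𝒜) (b𝒜≡⊤ : b 𝒜 ≡ ⊤)
  (maximal : ∀ 𝒞 → Chain 𝒜 𝒞 → length 𝒞 ≤ 4) {ℬ : Family n} (isℬ : Isℬ 𝒜 ℬ) (∣ℬ∣≡4 : length ℬ ≡ 4) where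

  open UnionClosed uc using (distinct; ∪-closed)

  private
    m : ℕ
    m = ⌊ n /2⌋

  ⊤∈𝒜 : ⊤ ∈ᶠ 𝒜
  ⊤∈𝒜 = subst (_∈ᶠ 𝒜) b𝒜≡⊤ (b𝒜∈𝒜 uc)

  noChain₅ : ∀ {V W X Y Z} → V ∈ᶠ 𝒜 → W ∈ᶠ 𝒜 → X ∈ᶠ 𝒜 → Y ∈ᶠ 𝒜 → Z ∈ᶠ 𝒜 →
    ¬ (V ⊂ W × W ⊂ X × X ⊂ Y × Y ⊂ Z)
  noChain₅ {V} {W} {X} {Y} {Z} V∈ W∈ X∈ Y∈ Z∈ (V⊂W , W⊂X , X⊂Y , Y⊂Z) = <-irrefl refl
    (maximal (V ∷ W ∷ X ∷ Y ∷ Z ∷ []) (Linked⇒Chain (V⊂W ∷ W⊂X ∷ X⊂Y ∷ Y⊂Z ∷ [-])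
      (All.lookup (V∈ ∷ W∈ ∷ X∈ ∷ Y∈ ∷ Z∈ ∷ []))))

  record Small (A : Subset n) : Set where
    constructor small
    field
      ∈𝒜  : A ∈ᶠ 𝒜
      <n/2 : ∣ A ∣ + ∣ A ∣ < n
  open Small

  small⇒∈ : ∀ {A} → Small A → A ∈ᶠ belowHalf 𝒜
  small⇒∈ (small A∈ lt) = ∈-belowHalf⁺ A∈ lt

  threeSmall≢B : ∀ {x y z} → Small x → Small y → Small z → (x ∪ y) ∪ z ≢ b (belowHalf 𝒜)
  threeSmall≢B {x} {y} {z} sx sy sz covers = <⇒≱ {3} ≤-refl (subst (_≤ 3) ∣ℬ∣≡4
    (ℬ-minimum isℬ (x ∷ y ∷ z ∷ []) (All.lookup (small⇒∈ sx ∷ small⇒∈ sy ∷ small⇒∈ sz ∷ []))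
      (trans (trans (cong (λ t → x ∪ (y ∪ t)) (∪-identityʳ z)) (sym (∪-assoc x y z))) covers)))

  -- The union is required to be `b (belowHalf 𝒜)` and not `⊤`, because `B≡⊤` is itself derived from
  -- the existence of a cover.
  record Cover (w x y z : Subset n) : Set where
    constructor cover
    field
      sw    : Small w
      sx    : Small x
      sy    : Small y
      sz    : Small z
      union : ((w ∪ x) ∪ y) ∪ z ≡ b (belowHalf 𝒜)

    w∈ : w ∈ᶠ 𝒜
    w∈ = ∈𝒜 sw

    wx∈ : w ∪ x ∈ᶠ 𝒜
    wx∈ = ∪-closed w∈ (∈𝒜 sx)

    wxy∈ : (w ∪ x) ∪ y ∈ᶠ 𝒜
    wxy∈ = ∪-closed wx∈ (∈𝒜 sy)

    -- If adding a set to the partial union gained nothing, the other three small sets would already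
    -- cover. The next two inclusions hold for the same reason.
    w⊂wx : w ⊂ w ∪ x
    w⊂wx = p∪q≢p⇒p⊂p∪q λ wx≡w → threeSmall≢B sw sy sz (trans (cong (λ t → (t ∪ y) ∪ z) (sym wx≡w)) union)

    wx⊂wxy : w ∪ x ⊂ (w ∪ x) ∪ y
    wx⊂wxy = p∪q≢p⇒p⊂p∪q λ wxy≡wx → threeSmall≢B sw sx sz (trans (cong (_∪ z) (sym wxy≡wx)) union)

    wxy⊂wxyz : (w ∪ x) ∪ y ⊂ ((w ∪ x) ∪ y) ∪ z
    wxy⊂wxyz = p∪q≢p⇒p⊂p∪q λ wxyz≡wxy → threeSmall≢B sw sx sy (trans (sym wxyz≡wxy) union)

  open Cover

  ∃Cover : ∃ λ w → ∃ λ x → ∃ λ y → ∃ λ z → Cover w x y z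
  ∃Cover = go ℬ ∣ℬ∣≡4 (proj₂ (IrredundantCover.subfamily ℬ-cover)) (IrredundantCover.covers ℬ-cover)
    where
    ℬ-cover = Isℬ.cover isℬ
    go : (𝒮 : Family n) → length 𝒮 ≡ 4 → 𝒮 ⊆ᶠ belowHalf 𝒜 → b 𝒮 ≡ b (belowHalf 𝒜) →
      ∃ λ w → ∃ λ x → ∃ λ y → ∃ λ z → Cover w x y z
    go (p ∷ q ∷ r ∷ s ∷ []) refl 𝒮⊆ covers = p , q , r , s , cover
      (∈⇒small (here refl)) (∈⇒small (there (here refl))) (∈⇒small (there (there (here refl))))
      (∈⇒small (there (there (there (here refl)))))
      (trans (trans (∪-assoc (p ∪ q) r s) (trans (∪-assoc p q (r ∪ s))
        (cong (λ t → p ∪ (q ∪ (r ∪ t))) (sym (∪-identityʳ s))))) covers)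
      where
      ∈⇒small : ∀ {S} → S ∈ᶠ (p ∷ q ∷ r ∷ s ∷ []) → Small S
      ∈⇒small S∈ = let S∈𝒜 , lt = ∈-belowHalf⁻ {𝒜 = 𝒜} (𝒮⊆ S∈) in small S∈𝒜 lt

  -- Otherwise `⊤` would extend the chain of four partial unions of a cover to a fifth member.
  B≡⊤ : b (belowHalf 𝒜) ≡ ⊤
  B≡⊤ = decidable-stable (b (belowHalf 𝒜) ≟ˢ ⊤) λ B≢⊤ →
    let _ , _ , _ , _ , c = ∃Cover in
    noChain₅ (w∈ c) (wx∈ c) (wxy∈ c) (∪-closed (wxy∈ c) (∈𝒜 (sz c))) ⊤∈𝒜
      (w⊂wx c , wx⊂wxy c , wxy⊂wxyz c , p≢⊤⇒p⊂⊤ λ eq → B≢⊤ (trans (sym (union c)) eq))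

  union≡⊤ : ∀ {w x y z} → Cover w x y z → ((w ∪ x) ∪ y) ∪ z ≡ ⊤
  union≡⊤ c = trans (union c) B≡⊤

  threeSmall≢⊤ : ∀ {x y z} → Small x → Small y → Small z → (x ∪ y) ∪ z ≢ ⊤
  threeSmall≢⊤ sx sy sz eq = threeSmall≢B sx sy sz (trans eq (sym B≡⊤))

  wxy⊂⊤ : ∀ {w x y z} → Cover w x y z → (w ∪ x) ∪ y ⊂ ⊤
  wxy⊂⊤ c = p≢⊤⇒p⊂⊤ (threeSmall≢⊤ (sw c) (sx c) (sy c))

  rotate : ∀ {w x y z} → Cover w x y z → Cover x y z w
  rotate {w} {x} {y} {z} (cover sw sx sy sz union) = cover sx sy sz sw
    (trans (∪-comm ((x ∪ y) ∪ z) w) (trans (sym (∪-assoc w (x ∪ y) z))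
      (trans (cong (_∪ z) (sym (∪-assoc w x y))) union)))

  -- Two elements missed by three members of a cover would be separated by
  -- some A ∈ 𝒜, whose union with the triple fits strictly below ⊤.
  gap≤1 : ∀ {w x y z} → Cover w x y z → ∣ ∁ ((w ∪ x) ∪ y) ∣ ≤ 1
  gap≤1 {w} {x} {y} c = ∣p∣≤1 (∁ ((w ∪ x) ∪ y)) λ {s} {t} s∈ t∈ → decidable-stable (s ≟ᶠ t) λ s≢t →
    case separating s t s≢t of λ where
      (A , A∈ , inj₁ (s∈A , t∉A)) → between A∈ (x∈∁p⇒x∉p s∈) s∈A (x∈∁p⇒x∉p t∈) t∉A
      (A , A∈ , inj₂ (s∉A , t∈A)) → between A∈ (x∈∁p⇒x∉p t∈) t∈A (x∈∁p⇒x∉p s∈) s∉A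
    where
    between : ∀ {A s t} → A ∈ᶠ 𝒜 → s ∉ (w ∪ x) ∪ y → s ∈ A → t ∉ (w ∪ x) ∪ y → ¬ (t ∉ A)
    between {A} {s} {t} A∈ s∉ s∈A t∉ t∉A =
      noChain₅ (w∈ c) (wx∈ c) (wxy∈ c) (∪-closed (wxy∈ c) A∈) ⊤∈𝒜
        (w⊂wx c , wx⊂wxy c , (p⊆p∪q A , s , q⊆p∪q ((w ∪ x) ∪ y) A s∈A , s∉) , (⊆⊤ , t , ∈⊤ , x∉p∪q t∉ t∉A))

  -- The remainder `k ≤ l` is carried along because the gaps sit inside a right-nested sum.
  gaps≤4 : ∀ {w x y z k l} → Cover w x y z → k ≤ l →
    ∣ ∁ ((w ∪ x) ∪ y) ∣ + (∣ ∁ ((x ∪ y) ∪ z) ∣ + (∣ ∁ ((y ∪ z) ∪ w) ∣ + (∣ ∁ ((z ∪ w) ∪ x) ∣ + k))) ≤ 4 + l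
  gaps≤4 c k≤l = +-mono-≤ (gap≤1 c) (+-mono-≤ (gap≤1 (rotate c)) (+-mono-≤ (gap≤1 (rotate (rotate c)))
    (+-mono-≤ (gap≤1 (rotate (rotate (rotate c)))) k≤l)))

  cover-bound : ∀ {w x y z} → Cover w x y z → n + n ≤ ((∣ w ∣ + ∣ x ∣) + (∣ y ∣ + ∣ z ∣)) + 4
  cover-bound {w} {x} {y} {z} c = begin
    n + n                                    ≡⟨ cong₂ _+_ (sym (∣⊤∣≡n n)) (trans (sym (∣⊤∣≡n n)) (sym (+-identityʳ ∣ ⊤ {n} ∣))) ⟩
    totalSize {n} (⊤ ∷ ⊤ ∷ [])               ≤⟨ gaps-bound w x y z ⟩
    totalSize (withGaps w x y z [])          ≤⟨ +-monoʳ-≤ ∣ w ∣ (+-monoʳ-≤ ∣ x ∣ (+-monoʳ-≤ ∣ y ∣ (+-monoʳ-≤ ∣ z ∣ (gaps≤4 c ≤-refl)))) ⟩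
    ∣ w ∣ + (∣ x ∣ + (∣ y ∣ + (∣ z ∣ + 4)))  ≡⟨ eq (∣ w ∣) (∣ x ∣) (∣ y ∣) (∣ z ∣) ⟩
    ((∣ w ∣ + ∣ x ∣) + (∣ y ∣ + ∣ z ∣)) + 4  ∎
    where
    open ≤-Reasoning
    eq : ∀ w x y z → w + (x + (y + (z + 4))) ≡ ((w + x) + (y + z)) + 4
    eq = solve-∀

  -- The unions `A`, `A ∪ w`, `(A ∪ w) ∪ x`, `((A ∪ w) ∪ x) ∪ y`, `⊤` cannot form a 5-chain, so two
  -- consecutive ones agree. The member added at that step can be replaced by `A`.
  exchange : ∀ {A w x y z} → Small A → Cover w x y z →
    Cover A x y z ⊎ Cover A w y z ⊎ Cover A w x z ⊎ Cover A w x y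
  exchange {A} {w} {x} {y} {z} sA c = case (A ∪ w) ≟ˢ A of λ where
      (yes eq) → inj₁ (cover sA (sx c) (sy c) (sz c) (toB (subst (λ t → ((t ∪ x) ∪ y) ∪ z ≡ ⊤) eq full)))
      (no A≢) → case ((A ∪ w) ∪ x) ≟ˢ (A ∪ w) of λ where
        (yes eq) → inj₂ (inj₁ (cover sA (sw c) (sy c) (sz c) (toB (subst (λ t → (t ∪ y) ∪ z ≡ ⊤) eq full))))
        (no Aw≢) → case (((A ∪ w) ∪ x) ∪ y) ≟ˢ ((A ∪ w) ∪ x) of λ where
          (yes eq) → inj₂ (inj₂ (inj₁ (cover sA (sw c) (sx c) (sz c) (toB (subst (λ t → t ∪ z ≡ ⊤) eq full)))))
          (no Awx≢) → inj₂ (inj₂ (inj₂ (cover sA (sw c) (sx c) (sy c) (toB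
            (decidable-stable ((((A ∪ w) ∪ x) ∪ y) ≟ˢ ⊤) λ Awxy≢ →
              noChain₅ A∈ Aw∈ Awx∈ (∪-closed Awx∈ (∈𝒜 (sy c))) ⊤∈𝒜
                (p∪q≢p⇒p⊂p∪q A≢ , p∪q≢p⇒p⊂p∪q Aw≢ , p∪q≢p⇒p⊂p∪q Awx≢ , p≢⊤⇒p⊂⊤ Awxy≢))))))
    where
    A∈ = ∈𝒜 sA
    Aw∈ = ∪-closed A∈ (w∈ c)
    Awx∈ = ∪-closed Aw∈ (∈𝒜 (sx c))
    toB : ∀ {p} → p ≡ ⊤ → p ≡ b (belowHalf 𝒜)
    toB eq = trans eq (sym B≡⊤)
    full : (((A ∪ w) ∪ x) ∪ y) ∪ z ≡ ⊤
    full = trans (cong (λ t → (t ∪ y) ∪ z) (∪-assoc A w x)) (trans (cong (_∪ z) (∪-assoc A (w ∪ x) y))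
      (trans (∪-assoc A ((w ∪ x) ∪ y) z) (trans (cong (A ∪_) (union≡⊤ c)) (∪-zeroʳ A))))

  small⇒Cover : ∀ {A} → Small A → ∃ λ x → ∃ λ y → ∃ λ z → Cover A x y z
  small⇒Cover sA = let _ , _ , _ , _ , c = ∃Cover in case exchange sA c of λ where
    (inj₁ c′)               → _ , _ , _ , c′
    (inj₂ (inj₁ c′))        → _ , _ , _ , c′
    (inj₂ (inj₂ (inj₁ c′))) → _ , _ , _ , c′
    (inj₂ (inj₂ (inj₂ c′))) → _ , _ , _ , c′

  -- A member strictly inside `A` would precede the chain `A`, `A ∪ x`, `(A ∪ x) ∪ y`, `⊤` obtained
  -- from a cover containing `A`.
  small-minimal : ∀ {A X} → Small A → X ∈ᶠ 𝒜 → ¬ (X ⊂ A)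
  small-minimal sA X∈ X⊂A = let _ , _ , _ , c = small⇒Cover sA in
    noChain₅ X∈ (w∈ c) (wx∈ c) (wxy∈ c) ⊤∈𝒜 (X⊂A , w⊂wx c , wx⊂wxy c , wxy⊂⊤ c)

  -- Deficient sets

  Deficient : Subset n → Set
  Deficient A = A ∈ᶠ 𝒜 × 2 + ∣ A ∣ ≤ m

  deficient⇒small : ∀ {A} → Deficient A → Small A
  deficient⇒small {A} (A∈ , def) = small A∈ (begin
    suc (∣ A ∣ + ∣ A ∣)        ≤⟨ s≤s (≤-trans (m≤n+m _ 3) (≤-reflexive (eq ∣ A ∣))) ⟩
    (2 + ∣ A ∣) + (2 + ∣ A ∣)  ≤⟨ +-mono-≤ def def ⟩
    m + m                      ≤⟨ ⌊n/2⌋+⌊n/2⌋≤n n ⟩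
    n                          ∎)
    where
    open ≤-Reasoning
    eq : ∀ k → 3 + (k + k) ≡ suc k + (2 + k)
    eq = solve-∀

  deficient-tight : ∀ {D x y z} → Deficient D → Cover D x y z →
    n ≡ suc (m + m) × 2 + ∣ D ∣ ≡ m × ∣ x ∣ ≡ m × ∣ y ∣ ≡ m × ∣ z ∣ ≡ m
  deficient-tight (_ , def) c = tight-cover (n≡2⌊n/2⌋⊎1+2⌊n/2⌋ n) def
    (<n/2 (sx c)) (<n/2 (sy c)) (<n/2 (sz c)) (cover-bound c)

  -- In the other outcomes of `exchange`, `D` accompanies `E` in a cover; by `deficient-tight` it
  -- would then have size `m`, yet it is deficient.
  deficient-exchange : ∀ {D E x y z} → Deficient D → Deficient E → Cover D x y z → Cover E x y z
  deficient-exchange {D} {E} (_ , D<) defE c = case exchange (deficient⇒small defE) c of λ where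
      (inj₁ c′)               → c′
      (inj₂ (inj₁ c′))        → contradiction (D≡m c′) D≢m
      (inj₂ (inj₂ (inj₁ c′))) → contradiction (D≡m c′) D≢m
      (inj₂ (inj₂ (inj₂ c′))) → contradiction (D≡m c′) D≢m
    where
    D≡m : ∀ {s t} → Cover E D s t → ∣ D ∣ ≡ m
    D≡m c′ = proj₁ (proj₂ (proj₂ (deficient-tight defE c′)))
    D≢m : ∣ D ∣ ≢ m
    D≢m eq = <-irrefl eq (<-≤-trans (s≤s (n≤1+n _)) D<)

  -- A small `D ∪ E` would be minimal and so equal to `D`; then `E` would lie strictly inside `D`,
  -- against the minimality of `D`.
  deficient-∪ : ∀ {D E} → Deficient D → Deficient E → D ≢ E → n ≤ ∣ D ∪ E ∣ + ∣ D ∪ E ∣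
  deficient-∪ {D} {E} defD defE D≢E = ≮⇒≥ λ lt → small-minimal (small (∪-closed (proj₁ defD) (proj₁ defE)) lt) (proj₁ defD)
    (p∪q≢p⇒p⊂p∪q λ D∪E≡D → small-minimal (deficient⇒small defD) (proj₁ defE)
      (⊆∧≢⇒⊂ (λ x∈E → subst (_ ∈_) D∪E≡D (q⊆p∪q D E x∈E)) D≢E))

  -- The element `s` is covered by `x` alone in both covers. For `D ≢ E` it makes the gap of
  -- `D ∪ E`, `y`, `z` nonempty; the gap of `x`, `y`, `z` is nonempty as well, and `D ∪ E` has more
  -- than `m` elements, so `twoGaps-bound` is violated.
  deficient-disjointGaps : ∀ {D E x y z s} → Deficient D → Deficient E → Cover D x y z → Cover E x y z →
    s ∉ (D ∪ y) ∪ z → s ∉ (E ∪ y) ∪ z → D ≡ E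
  deficient-disjointGaps {D} {E} {x} {y} {z} {s} defD defE cD cE s∉D s∉E = decidable-stable (D ≟ˢ E) λ D≢E →
    let n≡ , d≡ , x≡ , y≡ , z≡ = deficient-tight defD cD
        _ , e≡ , _ = deficient-tight defE cE
    in twoGaps-absurd {u = ∣ D ∪ E ∣} n≡ d≡ e≡ x≡ y≡ z≡ (≤-trans (≤-reflexive (sym n≡)) (deficient-∪ defD defE D≢E))
      (1≤∣∁p∣ (threeSmall≢⊤ (sx cD) (sy cD) (sz cD)))
      (1≤∣∁p∣ λ eq → s∉ (subst (s ∈_) (sym eq) ∈⊤))
      (subst (λ k → k + (k + (k + (k + lhs))) ≤ k + (k + rhs)) (∣⊤∣≡n n)
        (≤-trans (twoGaps-bound D E x y z) (+-monoʳ-≤ ∣ ⊤ {n} ∣ (+-monoʳ-≤ ∣ ⊤ {n} ∣ ≤rhs))))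
    where
    lhs rhs : ℕ
    lhs = totalSize ((D ∪ E) ∷ x ∷ y ∷ z ∷ ∁ ((x ∪ y) ∪ z) ∷ ∁ (((D ∪ E) ∪ y) ∪ z) ∷ [])
    rhs = ∣ D ∣ + (∣ x ∣ + (∣ y ∣ + (∣ z ∣ + (4 + (∣ E ∣ + (∣ x ∣ + (∣ y ∣ + (∣ z ∣ + (4 + 0)))))))))
    ≤rhs : totalSize (withGaps D x y z (withGaps E x y z [])) ≤ rhs
    ≤rhs = +-monoʳ-≤ ∣ D ∣ (+-monoʳ-≤ ∣ x ∣ (+-monoʳ-≤ ∣ y ∣ (+-monoʳ-≤ ∣ z ∣ (gaps≤4 cD
      (+-monoʳ-≤ ∣ E ∣ (+-monoʳ-≤ ∣ x ∣ (+-monoʳ-≤ ∣ y ∣ (+-monoʳ-≤ ∣ z ∣ (gaps≤4 cE ≤-refl)))))))))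
    s∉ : s ∉ ((D ∪ E) ∪ y) ∪ z
    s∉ = x∉p∪q (x∉p∪q (x∉p∪q (∉₁ s∉D) (∉₁ s∉E)) (∉₂ s∉D)) (∉₃ s∉D)

  -- One deficient `D` fixes `x`, `y`, `z`, which then complete every deficient set to a cover. Each
  -- is assigned an element that `x` alone covers, and these differ by `deficient-disjointGaps`.
  ∣deficient∣≤m : length (filter (deficient? m) 𝒜) ≤ m
  ∣deficient∣≤m = case any? (deficient? m) 𝒜 of λ where
      (no none) → subst (_≤ m) (sym (cong length (filter-none (deficient? m) (¬Any⇒All¬ 𝒜 none)))) z≤n
      (yes some) →
        let D , D∈ , D< = find some
            x , y , z , c = small⇒Cover (deficient⇒small (D∈ , D<))
            _ , _ , x≡m , _ = deficient-tight (D∈ , D<) c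
        in subst (_ ≤_) x≡m (length≤∣p∣ (λ E s → s ∉ (E ∪ y) ∪ z) (filter (deficient? m) 𝒜) x
          (filter⁺ (deficient? m) distinct)
          (λ E∈ → ownElement (deficient-exchange (D∈ , D<) (∈-filter⁻ (deficient? m) E∈) c))
          λ E∈ F∈ → let defE = ∈-filter⁻ (deficient? m) E∈ ; defF = ∈-filter⁻ (deficient? m) F∈ in
            deficient-disjointGaps defE defF
              (deficient-exchange (D∈ , D<) defE c) (deficient-exchange (D∈ , D<) defF c))
    where
    ownElement : ∀ {E x y z} → Cover E x y z → ∃ λ s → s ∈ x × s ∉ (E ∪ y) ∪ z
    ownElement {E} {x} {y} {z} c =
      let _ , s , _ , s∉ = p≢⊤⇒p⊂⊤ (threeSmall≢⊤ (sw c) (sy c) (sz c)) in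
      s , decidable-stable (s ∈? x) (λ s∉x → x∉p∪q (x∉p∪q (x∉p∪q (∉₁ s∉) s∉x) (∉₂ s∉)) (∉₃ s∉)
        (subst (s ∈_) (sym (union≡⊤ c)) ∈⊤)) , s∉

  -- The average size

  m≤2+∣A∣ : ∀ {A} → A ∈ᶠ 𝒜 → m ≤ 2 + ∣ A ∣
  m≤2+∣A∣ {A} A∈ = case deficient? m A of λ where
    (yes A<) → let _ , _ , _ , c = small⇒Cover (deficient⇒small (A∈ , A<))
                   _ , eq , _ = deficient-tight (A∈ , A<) c
               in ≤-reflexive (sym eq)
    (no A≮) → <⇒≤ (≰⇒> A≮)

  average-bound : m * length 𝒜 < totalSize 𝒜 + length 𝒜
  average-bound = +-cancelʳ-≤ n _ _ (begin
    suc (m * length 𝒜) + n                                                ≡⟨ sym (+-suc (m * length 𝒜) n) ⟩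
    m * length 𝒜 + suc n                                                  ≤⟨ size-bound-⊤ m 𝒜 m≤2+∣A∣ ⊤∈𝒜 ⟩
    ((totalSize 𝒜 + length 𝒜) + length (filter (deficient? m) 𝒜)) + m    ≡⟨ +-assoc (totalSize 𝒜 + length 𝒜) _ m ⟩
    -- The deficit, at most `m`, and the `m` displaced by `⊤` together stay within `n`; the strict
    -- inequality comes from the `suc` in the contribution `suc n` of `⊤`.
    (totalSize 𝒜 + length 𝒜) + (length (filter (deficient? m) 𝒜) + m)    ≤⟨ +-monoʳ-≤ (totalSize 𝒜 + length 𝒜) (+-monoˡ-≤ m ∣deficient∣≤m) ⟩
    (totalSize 𝒜 + length 𝒜) + (m + m)                                    ≤⟨ +-monoʳ-≤ (totalSize 𝒜 + length 𝒜) (⌊n/2⌋+⌊n/2⌋≤n n) ⟩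
    (totalSize 𝒜 + length 𝒜) + n                                          ∎)
    where open ≤-Reasoning

theorem4p1 : (n h : ℕ) (𝒜 ℬ : Family n) (uc : UnionClosed 𝒜) →
    Separating 𝒜 → b 𝒜 ≡ ⊤ → HasHeight 𝒜 h → Isℬ 𝒜 ℬ →
    h ≡ length ℬ → length ℬ ≡ 4 →
    Avg 𝒜 {{unionClosed⇒nonZero uc}} > (+ ⌊ n /2⌋ / 1) - 1ℚ
theorem4p1 n h 𝒜 ℬ uc separating b𝒜≡⊤ height isℬ h≡∣ℬ∣ ∣ℬ∣≡4 =
  m-1</ ⌊ n /2⌋ (totalSize 𝒜) (length 𝒜) {{unionClosed⇒nonZero uc}}
    (average-bound uc separating b𝒜≡⊤
      (subst (λ k → ∀ 𝒞 → Chain 𝒜 𝒞 → length 𝒞 ≤ k) (trans h≡∣ℬ∣ ∣ℬ∣≡4) (HasHeight.maximal height)) isℬ ∣ℬ∣≡4)
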